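{- Let $T$ be a tree with $m$ edges, with notation as in the context. Let $f:\mathbb{N}\times\mathbb{N}\to\mathbb{N}$ be a function with the following property: for all natural numbers $m',\lambda$, all $b'\ge 0$ and positive integers $m_1,\ldots,m_{b'+1}$ with $m'=m_1+\cdots+m_{b'+1}$, every $f(m',\lambda)$-edge-connected bipartite graph $H$ on classes $A',B'$ in which all vertices of $A'$ have degree divisible by $m'$ can be decomposed into $b'+1$ spanning $\lambda$-edge-connected graphs $H_1,\ldots,H_{b'+1}$ with $d(v,H_i)=\frac{m_i}{m'}d(v,H)$ for $v\in A'$, $i\in\{1,\ldots,b'+1\}$, and $d(v,H_i)$ divisible by $m_i$ for $v\in B'$, $i\in\{1,\ldots,b'\}$ (such a function exists). Let $d$ be a natural number and let $G$ be a bipartite graph on vertex classes $A$ and $B$ in which every vertex of $A$ has degree divisible by $m$. If $G$ is $f(m,md)$-edge-connected, then $G$ admits a $T$-equitable edge-colouring in which every vertex has at least $d$ incident edges of each colour $1,\ldots,m$.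
   Context: All graphs are finite and loopless but may have multiple edges. Let $T_A$, $T_B$ be the two vertex classes of a proper $2$-colouring of $T$, chosen so that $T_B$ contains a leaf of $T$. Denote the non-leaves of $T$ in $T_A$ by $t_1,\ldots,t_a$ and those in $T_B$ by $t_{a+1},\ldots,t_{a+b}$. Colour the edges of $T$ with colours $1,\ldots,m$, distinct edges getting distinct colours, and let $T(i)$ be the set of colours at $t_i$. For an edge-colouring of $G$, $d_j(v)$ is the number of edges of colour $j$ at $v$. An edge-colouring of $G$ with colours $1,\ldots,m$ is $T$-equitable if for every $v\in A$, $i\in\{1,\ldots,a\}$, $j,k\in T(i)$ we have $d_j(v)=d_k(v)$, and for every $v\in B$, $i\in\{a+1,\ldots,a+b\}$, $j,k\in T(i)$ we have $d_j(v)=d_k(v)$. -}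

module Defs where

open import Data.Fin using (Fin; zero; suc; inject₁; fromℕ; _≟_)
open import Data.Fin.Subset using (Subset; ⊤; ∣_∣; _∈_; _⊆_; _∩_; _─_)
open import Data.Nat using (ℕ; suc; _*_; _≤_; _<_)
open import Data.Nat.Divisibility using (_∣_)
open import Data.Product using (∃-syntax; _×_)
open import Data.Sum using (_⊎_)
open import Data.Vec using (Vec; tabulate; lookup; sum)
open import Function.Definitions using (Injective)
open import Relation.Binary.Construct.Closure.ReflexiveTransitive using (Star)
open import Relation.Binary.PropositionalEquality using (_≡_; _≢_)
open import Relation.Nullary using (¬_; Dec; does)
open import Relation.Nullary.Decidable using (_⊎-dec_)

-- A finite loopless multigraph with vertex set Fin n and edge set Fin m.
-- Edges are undirected: every notion below is symmetric in end₁ and end₂.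
record Graph (n m : ℕ) : Set where
  field
    end₁ end₂ : Fin m → Fin n
    loopless  : ∀ e → end₁ e ≢ end₂ e

open Graph public

-- A spanning subgraph of G : Graph n m is given by its edge set S : Subset m;
-- G itself corresponds to S = ⊤.

module _ {n m : ℕ} (G : Graph n m) where

  Incident : Fin m → Fin n → Set
  Incident e v = end₁ G e ≡ v ⊎ end₂ G e ≡ v

  incident? : ∀ e v → Dec (Incident e v)
  incident? e v = (end₁ G e ≟ v) ⊎-dec (end₂ G e ≟ v)

  Joins : Fin m → Fin n → Fin n → Set
  Joins e u v = (end₁ G e ≡ u × end₂ G e ≡ v) ⊎ (end₁ G e ≡ v × end₂ G e ≡ u)

  edgesAt : Fin n → Subset m
  edgesAt v = tabulate (λ e → does (incident? e v))

  degreeIn : Subset m → Fin n → ℕ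
  degreeIn S v = ∣ S ∩ edgesAt v ∣

  degree : Fin n → ℕ
  degree = degreeIn ⊤

  AdjacentIn : Subset m → Fin n → Fin n → Set
  AdjacentIn S u v = ∃[ e ] e ∈ S × Joins e u v

  ConnectedIn : Subset m → Set
  ConnectedIn S = ∀ u v → Star (AdjacentIn S) u v

  -- As usual, a k-edge-connected graph has more than one vertex.
  EdgeConnectedIn : ℕ → Subset m → Set
  EdgeConnectedIn k S =
    2 ≤ n × (∀ (F : Subset m) → F ⊆ S → ∣ F ∣ < k → ConnectedIn (S ─ F))

  EdgeConnected : ℕ → Set
  EdgeConnected k = EdgeConnectedIn k ⊤

  -- A cycle of length l + 2; length 2 is a pair of parallel edges.
  record Cycle : Set where
    field
      l                : ℕ
      vertex           : Fin (suc (suc l)) → Fin n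
      edge             : Fin (suc (suc l)) → Fin m
      vertex-injective : Injective _≡_ _≡_ vertex
      edge-injective   : Injective _≡_ _≡_ edge
      joins            : ∀ (i : Fin (suc l)) →
                         Joins (edge (inject₁ i)) (vertex (inject₁ i)) (vertex (suc i))
      closes           : Joins (edge (fromℕ (suc l))) (vertex (fromℕ (suc l))) (vertex zero)

  record IsTree : Set where
    field
      nonempty  : 1 ≤ n
      connected : ConnectedIn ⊤
      acyclic   : ¬ Cycle

  Leaf : Fin n → Set
  Leaf v = degree v ≡ 1

data Class : Set where
  A B : Class

record Bipartition {n m : ℕ} (G : Graph n m) : Set where
  field
    class  : Fin n → Class
    proper : ∀ e → class (end₁ G e) ≢ class (end₂ G e)

open Bipartition public

colourClass : ∀ {m k} → (Fin m → Fin k) → Fin k → Subset m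
colourClass c j = tabulate (λ e → does (c e ≟ j))

-- d_j(v)
colourDegree : ∀ {n m k} → Graph n m → (Fin m → Fin k) → Fin k → Fin n → ℕ
colourDegree G c j v = degreeIn G (colourClass c j) v

-- j ∈ T(t), where κ is the colouring of the edges of T
ColourAt : ∀ {n m k} → Graph n m → (Fin m → Fin k) → Fin n → Fin k → Set
ColourAt T κ t j = ∃[ e ] Incident T e t × κ e ≡ j

TEquitable : ∀ {nT m n e}
  (T : Graph nT m) (P : Bipartition T) (κ : Fin m → Fin m)
  (G : Graph n e) (Q : Bipartition G) (c : Fin e → Fin m) → Set
TEquitable T P κ G Q c =
  ∀ X v → class Q v ≡ X →
  ∀ t → class P t ≡ X → ¬ Leaf T t →
  ∀ j k → ColourAt T κ t j → ColourAt T κ t k →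
  colourDegree G c j v ≡ colourDegree G c k v

-- A decomposition of H into b + 1 spanning subgraphs H_i is a map h from the
-- edges of H to Fin (suc b), with H_i = colourClass h i.  The equation
-- d(v,H_i) = (m_i / m) d(v,H) is cleared of its denominator, where m > 0 since
-- the m_i are positive.
record Decomposes {n e b : ℕ} (m k : ℕ) (ms : Vec ℕ (suc b))
                  (H : Graph n e) (Q : Bipartition H)
                  (h : Fin e → Fin (suc b)) : Set where
  field
    edge-connected : ∀ i → EdgeConnectedIn H k (colourClass h i)
    degree-A       : ∀ v → class Q v ≡ A → ∀ i →
                     m * degreeIn H (colourClass h i) v ≡ lookup ms i * degree H v
    degree-B       : ∀ v → class Q v ≡ B → ∀ (i : Fin b) →
                     lookup ms (inject₁ i) ∣ degreeIn H (colourClass h (inject₁ i)) v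

DecompositionProperty : (ℕ → ℕ → ℕ) → Set
DecompositionProperty f =
  ∀ (m k b : ℕ) (ms : Vec ℕ (suc b)) →
  (∀ i → 0 < lookup ms i) → m ≡ sum ms →
  ∀ {n e} (H : Graph n e) (Q : Bipartition H) →
  EdgeConnected H (f m k) →
  (∀ v → class Q v ≡ A → m ∣ degree H v) →
  ∃[ h ] Decomposes m k ms H Q h

{-# OPTIONS --safe #-}

-- The edges of T are grouped by their ends in T_B, with the group of the given
-- leaf last, and the hypothesis on f splits G into one spanning subgraph H_i per
-- group.  Each H_i is then coloured with the colours of its group so that at
-- every vertex the colours of the group have degrees differing by at most one.
-- If m_i, the number of these colours, divides d(v,H_i), then all of them have
-- degree d(v,H_i)/m_i at v: at v ∈ A this is d(v)/m for every colour, and at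
-- v ∈ B it applies to every group but that of the leaf, on which equitability
-- imposes nothing.  The lower bound follows from d(v,H_i) ≥ m d ≥ m_i d.
--
-- Such balanced colourings are built edge by edge: a new edge uv gets a colour α
-- that is rarest at u, and the edges coloured α or β, where β is rarest at v, are
-- recoloured evenly with α and β.  This last step uses an orientation with in-
-- and out-degrees differing by at most one, whose edges are coloured according
-- to whether they point from A to B or from B to A.
module Submission where

open import Defs
open import Algebra.Properties.Semiring.Sum as Sum using ()
open import Data.Bool using (Bool; true; false; if_then_else_)
open import Data.Fin using (Fin; zero; suc; punchIn; inject₁; fromℕ; _≟_)
open import Data.Fin.Permutation.Components using (transpose; transpose-inverse)
open import Data.Fin.Properties
  using (any?; punchInᵢ≢i; punchOut-injective; injective⇒≤; nonZeroIndex; suc-injective)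
open import Data.Fin.Relation.Unary.Top using (view; ‵fromℕ; ‵inject₁)
open import Data.Fin.Subset using (Subset; ⊤; ∣_∣; _∈_; _∉_; _∩_; _─_; Nonempty)
open import Data.Fin.Subset.Properties
  using (Empty-unique; ∣⊥∣≡0; nonempty?; x∈p∩q⁺; x∈p∩q⁻; p∩q⊆p; p─q⊆p)
open import Data.Integer using (ℤ; +_; -[1+_]; _◃_)
import Data.Integer as ℤ
import Data.Integer.Properties as ℤ
open import Data.Integer.Tactic.RingSolver using () renaming (solve-∀ to ℤ-solve-∀)
open import Data.Nat using (ℕ; zero; suc; _+_; _*_; _≤_; _<_; z≤n; s≤s; s≤s⁻¹; _≤?_; _<?_)
open import Data.Nat.Divisibility using (_∣_; divides)
open import Data.Nat.Properties hiding (_≟_; suc-injective)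
open import Data.Product using (∃-syntax; _×_; _,_; proj₁; proj₂)
open import Data.Sign using (Sign; opposite)
open import Data.Sum using (_⊎_; inj₁; inj₂)
import Data.Vec as Vec
open import Data.Vec.Functional using (Vector; updateAt; removeAt; tail)
open import Data.Vec.Functional.Properties using (updateAt-updates; updateAt-minimal)
import Data.Vec.Properties as Vec
open import Function using (_∘_; id; const)
open import Function.Definitions using (Injective)
open import Relation.Binary.Construct.Closure.ReflexiveTransitive using (Star; ε; _◅_)
open import Relation.Binary.PropositionalEquality
open import Relation.Nullary using (¬_; Dec; does; yes; no; contradiction)
open import Relation.Nullary.Decidable using (_⊎-dec_; _×-dec_; dec-true; dec-false)

open Sum +-*-semiring
module ℤ-Sum = Sum ℤ.+-*-semiring
open ℤ-Sum using () renaming (sum to ℤ-sum)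

-- Indicators and finite sums of integers.

indicator : {P : Set} → Dec P → ℕ
indicator P? = if does P? then 1 else 0

indicator-true : {P : Set} (P? : Dec P) → P → indicator P? ≡ 1
indicator-true P? p = cong (if_then 1 else 0) (dec-true P? p)

indicator-false : {P : Set} (P? : Dec P) → ¬ P → indicator P? ≡ 0
indicator-false P? ¬p = cong (if_then 1 else 0) (dec-false P? ¬p)

sum-zero : ∀ {n} {f : Vector ℤ n} → (∀ i → f i ≡ + 0) → ℤ-sum f ≡ + 0
sum-zero {n} f≗0 = trans (ℤ-Sum.sum-cong-≗ f≗0) (ℤ-Sum.sum-replicate-zero n)

sum-shift : ∀ {n} {f g : Vector ℤ n} i k →
            f i ≡ k ℤ.+ g i → (∀ j → j ≢ i → f j ≡ g j) →
            ℤ-sum f ≡ k ℤ.+ ℤ-sum g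
sum-shift {suc n} {f} {g} i k fᵢ f≗g = begin
  ℤ-sum f                                 ≡⟨ ℤ-Sum.sum-remove {i = i} f ⟩
  f i ℤ.+ ℤ-sum (removeAt f i)             ≡⟨ cong₂ ℤ._+_ fᵢ
                                              (ℤ-Sum.sum-cong-≗ λ j → f≗g _ (punchInᵢ≢i i j)) ⟩
  k ℤ.+ g i ℤ.+ ℤ-sum (removeAt g i)       ≡⟨ ℤ.+-assoc k (g i) _ ⟩
  k ℤ.+ (g i ℤ.+ ℤ-sum (removeAt g i))     ≡⟨ cong (λ z → k ℤ.+ z) (ℤ-Sum.sum-remove {i = i} g) ⟨
  k ℤ.+ ℤ-sum g                           ∎
  where open ≡-Reasoning

-- Orientations with in- and out-degrees differing by at most one.

⟦_⟧ : Sign → ℤ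
⟦ s ⟧ = s ◃ 1

⟦opposite⟧ : ∀ s → ⟦ opposite s ⟧ ≡ ℤ.- ⟦ s ⟧
⟦opposite⟧ Sign.+ = refl
⟦opposite⟧ Sign.- = refl

module _ {n : ℕ} where

  δ : Fin n → Fin n → ℤ
  δ p v = + indicator (p ≟ v)

  -- The boundary of an arc with tail `p` and head `q`; a loop has boundary zero.
  ∂ : Fin n → Fin n → Fin n → ℤ
  ∂ p q v = δ p v ℤ.- δ q v

  -- Out-degree minus in-degree at a vertex, where `Sign.+` directs edge `i` from `p i` to `q i` and
  -- `Sign.-` reverses it.
  net : ∀ {e} → (Fin e → Sign) → (p q : Fin e → Fin n) → Fin n → ℤ
  net σ p q v = ℤ-sum λ i → ⟦ σ i ⟧ ℤ.* ∂ (p i) (q i) v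

  ∂-zero : ∀ {p q v} → p ≢ v → q ≢ v → ∂ p q v ≡ + 0
  ∂-zero {p} {q} {v} p≢v q≢v =
    cong₂ (λ x y → + x ℤ.- + y) (indicator-false (p ≟ v) p≢v) (indicator-false (q ≟ v) q≢v)

  ∣∂∣≤1 : ∀ p q v → ℤ.∣ ∂ p q v ∣ ≤ 1
  ∣∂∣≤1 p q v with p ≟ v | q ≟ v
  ... | yes _ | yes _ = z≤n
  ... | yes _ | no _  = s≤s z≤n
  ... | no _  | yes _ = s≤s z≤n
  ... | no _  | no _  = z≤n

  Meets : ∀ {e} (p q : Fin e → Fin n) → Fin n → Fin e → Set
  Meets p q u i = p i ≡ u ⊎ q i ≡ u

  meets? : ∀ {e} (p q : Fin e → Fin n) u i → Dec (Meets p q u i)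
  meets? p q u i = (p i ≟ u) ⊎-dec (q i ≟ u)

  net-isolated : ∀ {e} σ (p q : Fin e → Fin n) {u} →
                 (∀ i → ¬ Meets p q u i) → net σ p q u ≡ + 0
  net-isolated σ p q {u} isolated = sum-zero λ i → begin
    ⟦ σ i ⟧ ℤ.* ∂ (p i) (q i) u ≡⟨ cong (⟦ σ i ⟧ ℤ.*_)
                                     (∂-zero (isolated i ∘ inj₁) (isolated i ∘ inj₂)) ⟩
    ⟦ σ i ⟧ ℤ.* + 0             ≡⟨ ℤ.*-zeroʳ ⟦ σ i ⟧ ⟩
    + 0                         ∎
    where open ≡-Reasoning

  Balanced : ∀ {e} (p q : Fin e → Fin n) → (Fin e → Sign) → Set
  Balanced p q σ = ∀ v → ℤ.∣ net σ p q v ∣ ≤ 1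

  -- Traversing edge 0 and edge i consecutively has the same boundary as
  -- traversing a single edge from x to y.
  unmerge : ∀ {e} (p q : Fin (suc e) → Fin n) i x y (f : Sign → Sign) →
            (∀ s v → ⟦ s ⟧ ℤ.* ∂ x y v ≡
              ⟦ f s ⟧ ℤ.* ∂ (p zero) (q zero) v ℤ.+ ⟦ s ⟧ ℤ.* ∂ (p (suc i)) (q (suc i)) v) →
            (∃[ σ ] Balanced (updateAt (tail p) i (const x)) (updateAt (tail q) i (const y)) σ) →
            ∃[ σ ] Balanced p q σ
  unmerge {e} p q i x y f merged (σ , balanced) = σ′ , λ v →
    subst (λ z → ℤ.∣ z ∣ ≤ 1) (same-net v) (balanced v)
    where
    σ′ : Fin (suc e) → Sign
    σ′ zero    = f (σ i)
    σ′ (suc j) = σ j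
    same-net : ∀ v → net σ (updateAt (tail p) i (const x)) (updateAt (tail q) i (const y)) v
                     ≡ net σ′ p q v
    same-net v = sum-shift i (⟦ f (σ i) ⟧ ℤ.* ∂ (p zero) (q zero) v)
      (trans (cong₂ (λ z w → ⟦ σ i ⟧ ℤ.* ∂ z w v)
                (updateAt-updates i (tail p)) (updateAt-updates i (tail q)))
             (merged (σ i) v))
      (λ j j≢i → cong₂ (λ z w → ⟦ σ j ⟧ ℤ.* ∂ z w v)
                (updateAt-minimal j i (tail p) j≢i) (updateAt-minimal j i (tail q) j≢i))

  -- Induction on the number of edges. If edge 0 shares an end with another edge, both are replaced
  -- by one edge between their other ends; expanding that edge again passes through the shared
  -- vertex once in and once out, so no net degree changes. If edge 0 meets no other edge, either
  -- direction will do.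
  orientation : ∀ {e} (p q : Fin e → Fin n) → ∃[ σ ] Balanced p q σ
  orientation {zero}  p q = (λ ()) , λ _ → z≤n
  orientation {suc e} p q
    with any? (meets? (tail p) (tail q) (p zero)) | any? (meets? (tail p) (tail q) (q zero))
  -- The merged edge always agrees in direction with edge `i`. Here it runs from `q zero` through
  -- the shared `p zero` to `q (suc i)`, hence along edge 0 backwards, which is why `f` is
  -- `opposite`. The next three cases differ in which ends coincide.
  ... | yes (i , inj₁ pᵢ≡p₀) | _ = unmerge p q i (q zero) (q (suc i)) opposite
    (λ s v → trans (identity ⟦ s ⟧ (δ (p zero) v) (δ (q zero) v) (δ (q (suc i)) v))
      (cong₂ (λ z w → z ℤ.* ∂ (p zero) (q zero) v ℤ.+ ⟦ s ⟧ ℤ.* ∂ w (q (suc i)) v)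
        (sym (⟦opposite⟧ s)) (sym pᵢ≡p₀)))
    (orientation (updateAt (tail p) i (const (q zero))) (updateAt (tail q) i (const (q (suc i)))))
    where
    identity : ∀ s a b c → s ℤ.* (b ℤ.- c) ≡ ℤ.- s ℤ.* (a ℤ.- b) ℤ.+ s ℤ.* (a ℤ.- c)
    identity = ℤ-solve-∀
  ... | yes (i , inj₂ qᵢ≡p₀) | _ = unmerge p q i (p (suc i)) (q zero) id
    (λ s v → trans (identity ⟦ s ⟧ (δ (p zero) v) (δ (q zero) v) (δ (p (suc i)) v))
      (cong (λ w → ⟦ s ⟧ ℤ.* ∂ (p zero) (q zero) v ℤ.+ ⟦ s ⟧ ℤ.* ∂ (p (suc i)) w v)
        (sym qᵢ≡p₀)))
    (orientation (updateAt (tail p) i (const (p (suc i)))) (updateAt (tail q) i (const (q zero))))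
    where
    identity : ∀ s a b c → s ℤ.* (c ℤ.- b) ≡ s ℤ.* (a ℤ.- b) ℤ.+ s ℤ.* (c ℤ.- a)
    identity = ℤ-solve-∀
  ... | no _ | yes (i , inj₁ pᵢ≡q₀) = unmerge p q i (p zero) (q (suc i)) id
    (λ s v → trans (identity ⟦ s ⟧ (δ (p zero) v) (δ (q zero) v) (δ (q (suc i)) v))
      (cong (λ w → ⟦ s ⟧ ℤ.* ∂ (p zero) (q zero) v ℤ.+ ⟦ s ⟧ ℤ.* ∂ w (q (suc i)) v)
        (sym pᵢ≡q₀)))
    (orientation (updateAt (tail p) i (const (p zero))) (updateAt (tail q) i (const (q (suc i)))))
    where
    identity : ∀ s a b c → s ℤ.* (a ℤ.- c) ≡ s ℤ.* (a ℤ.- b) ℤ.+ s ℤ.* (b ℤ.- c)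
    identity = ℤ-solve-∀
  ... | no _ | yes (i , inj₂ qᵢ≡q₀) = unmerge p q i (p (suc i)) (p zero) opposite
    (λ s v → trans (identity ⟦ s ⟧ (δ (p zero) v) (δ (q zero) v) (δ (p (suc i)) v))
      (cong₂ (λ z w → z ℤ.* ∂ (p zero) (q zero) v ℤ.+ ⟦ s ⟧ ℤ.* ∂ (p (suc i)) w v)
        (sym (⟦opposite⟧ s)) (sym qᵢ≡q₀)))
    (orientation (updateAt (tail p) i (const (p (suc i)))) (updateAt (tail q) i (const (p zero))))
    where
    identity : ∀ s a b c → s ℤ.* (c ℤ.- a) ≡ ℤ.- s ℤ.* (a ℤ.- b) ℤ.+ s ℤ.* (c ℤ.- b)
    identity = ℤ-solve-∀
  -- At the ends of edge 0 only its own boundary counts, and at all other vertices it contributes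
  -- nothing.
  ... | no isolated-p₀ | no isolated-q₀ with orientation (tail p) (tail q)
  ...   | σ , balanced = σ′ , bound
    where
    σ′ : Fin (suc e) → Sign
    σ′ zero    = Sign.+
    σ′ (suc j) = σ j
    rest : Fin n → ℤ
    rest = net σ (tail p) (tail q)
    net-σ′ : ∀ v → net σ′ p q v ≡ ∂ (p zero) (q zero) v ℤ.+ rest v
    net-σ′ v = cong (λ z → z ℤ.+ rest v) (ℤ.*-identityˡ (∂ (p zero) (q zero) v))
    at-end : ∀ v → (∀ i → ¬ Meets (tail p) (tail q) v i) → ℤ.∣ net σ′ p q v ∣ ≤ 1
    at-end v isolated = subst (λ z → ℤ.∣ z ∣ ≤ 1) (sym eq) (∣∂∣≤1 (p zero) (q zero) v)
      where
      open ≡-Reasoning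
      eq : net σ′ p q v ≡ ∂ (p zero) (q zero) v
      eq = begin
        net σ′ p q v                      ≡⟨ net-σ′ v ⟩
        ∂ (p zero) (q zero) v ℤ.+ rest v  ≡⟨ cong (λ z → ∂ (p zero) (q zero) v ℤ.+ z)
                                               (net-isolated σ (tail p) (tail q) isolated) ⟩
        ∂ (p zero) (q zero) v ℤ.+ + 0     ≡⟨ ℤ.+-identityʳ (∂ (p zero) (q zero) v) ⟩
        ∂ (p zero) (q zero) v             ∎
    off-ends : ∀ v → p zero ≢ v → q zero ≢ v → net σ′ p q v ≡ rest v
    off-ends v p₀≢v q₀≢v = begin
      net σ′ p q v                      ≡⟨ net-σ′ v ⟩
      ∂ (p zero) (q zero) v ℤ.+ rest v  ≡⟨ cong (λ z → z ℤ.+ rest v) (∂-zero p₀≢v q₀≢v) ⟩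
      + 0 ℤ.+ rest v                    ≡⟨ ℤ.+-identityˡ (rest v) ⟩
      rest v                            ∎
      where open ≡-Reasoning
    bound : Balanced p q σ′
    bound v = by-cases (p zero ≟ v) (q zero ≟ v)
      where
      by-cases : Dec (p zero ≡ v) → Dec (q zero ≡ v) → ℤ.∣ net σ′ p q v ∣ ≤ 1
      by-cases (yes refl) _          = at-end v λ i m → isolated-p₀ (i , m)
      by-cases (no _)     (yes refl) = at-end v λ i m → isolated-q₀ (i , m)
      by-cases (no p₀≢v)  (no q₀≢v)  =
        subst (λ z → ℤ.∣ z ∣ ≤ 1) (sym (off-ends v p₀≢v q₀≢v)) (balanced v)

-- Even recolouring with two colours.

+-sum : ∀ {n} (f : Vector ℕ n) → + sum f ≡ ℤ-sum (+_ ∘ f)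
+-sum {zero}  f = refl
+-sum {suc n} f = cong (λ z → + f zero ℤ.+ z) (+-sum (tail f))

close-from-difference : ∀ {a b} z → + a ≡ + b ℤ.+ z → ℤ.∣ z ∣ ≤ 1 → a ≤ suc b × b ≤ suc a
close-from-difference {b = b} (+ 0) refl z≤1 rewrite +-identityʳ b = n≤1+n b , n≤1+n b
close-from-difference {b = b} (+ 1) refl z≤1 rewrite +-comm b 1 = ≤-refl , m≤n⇒m≤1+n (n≤1+n b)
close-from-difference (+ suc (suc _)) _ (s≤s ())
close-from-difference {b = suc b} -[1+ 0 ] refl z≤1 = m≤n⇒m≤1+n (n≤1+n b) , ≤-refl
close-from-difference -[1+ suc _ ] _ (s≤s ())

⟦*⟧ : ∀ s t → ⟦ s Data.Sign.* t ⟧ ≡ ⟦ s ⟧ ℤ.* ⟦ t ⟧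
⟦*⟧ Sign.+ Sign.+ = refl
⟦*⟧ Sign.+ Sign.- = refl
⟦*⟧ Sign.- Sign.+ = refl
⟦*⟧ Sign.- Sign.- = refl

-- A sum over the two ends rather than the indicator of a disjunction, so that signs can be attached
-- end by end in `signed-incidence`.
incidence : ∀ {n e} (p q : Fin e → Fin n) → Fin e → Fin n → ℕ
incidence p q i v = indicator (p i ≟ v) + indicator (q i ≟ v)

countAt : ∀ {n e m} (p q : Fin e → Fin n) → (Fin e → Fin m) → Fin m → Fin n → ℕ
countAt p q c j v = sum λ i → indicator (c i ≟ j) * incidence p q i v

module Rebalance {n e m : ℕ} (p q : Fin e → Fin n)
  (χ : Fin n → Sign) (proper : ∀ i → χ (q i) ≡ opposite (χ (p i)))
  (c : Fin e → Fin m) {α β : Fin m} (α≢β : α ≢ β) where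

  Selected : Fin m → Set
  Selected j = j ≡ α ⊎ j ≡ β

  selected? : ∀ j → Dec (Selected j)
  selected? j = (j ≟ α) ⊎-dec (j ≟ β)

  -- Edges of other colours become loops, which do not affect the orientation.
  tailEnd : Fin e → Fin n
  tailEnd i = if does (selected? (c i)) then p i else q i

  σ : Fin e → Sign
  σ = proj₁ (orientation tailEnd q)

  paint : Sign → Fin m
  paint Sign.+ = α
  paint Sign.- = β

  -- The product of signs is `Sign.+` exactly when the edge is directed from the positive side of
  -- `χ` to the negative side, whichever of its ends is listed first.
  rebalanced : Fin e → Fin m
  rebalanced i = if does (selected? (c i)) then paint (σ i Data.Sign.* χ (p i)) else c i

  paint-selected : ∀ s → Selected (paint s)
  paint-selected Sign.+ = inj₁ refl
  paint-selected Sign.- = inj₂ refl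

  rebalanced-view : ∀ i → Selected (c i) × Selected (rebalanced i) ⊎
                          ¬ Selected (c i) × rebalanced i ≡ c i
  rebalanced-view i = by-cases (selected? (c i))
    where
    by-cases : (s? : Dec (Selected (c i))) →
      let colour = if does s? then paint (σ i Data.Sign.* χ (p i)) else c i in
      Selected (c i) × Selected colour ⊎ ¬ Selected (c i) × colour ≡ c i
    by-cases (yes s) = inj₁ (s , paint-selected (σ i Data.Sign.* χ (p i)))
    by-cases (no ¬s) = inj₂ (¬s , refl)

  selected-sum : ∀ {j} → Selected j → indicator (j ≟ α) + indicator (j ≟ β) ≡ 1
  selected-sum {j} (inj₁ j≡α) = cong₂ _+_ (indicator-true (j ≟ α) j≡α)
    (indicator-false (j ≟ β) (λ j≡β → α≢β (trans (sym j≡α) j≡β)))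
  selected-sum {j} (inj₂ j≡β) = cong₂ _+_
    (indicator-false (j ≟ α) (λ j≡α → α≢β (trans (sym j≡α) j≡β))) (indicator-true (j ≟ β) j≡β)

  -- An edge enters or leaves neither the set of selected edges nor its ends, so its joint
  -- contribution to the two counts is the same before and after.
  rebalanced-total : ∀ v → countAt p q rebalanced α v + countAt p q rebalanced β v
                           ≡ countAt p q c α v + countAt p q c β v
  rebalanced-total v = begin
    sum (term rebalanced α) + sum (term rebalanced β)
      ≡⟨ ∑-distrib-+ (term rebalanced α) (term rebalanced β) ⟨
    sum (λ i → term rebalanced α i + term rebalanced β i)   ≡⟨ sum-cong-≗ pointwise ⟩
    sum (λ i → term c α i + term c β i)                     ≡⟨ ∑-distrib-+ (term c α) (term c β) ⟩
    sum (term c α) + sum (term c β)                         ∎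
    where
    open ≡-Reasoning
    term : (Fin e → Fin m) → Fin m → Fin e → ℕ
    term c j i = indicator (c i ≟ j) * incidence p q i v
    colours : ∀ i → indicator (rebalanced i ≟ α) + indicator (rebalanced i ≟ β)
                    ≡ indicator (c i ≟ α) + indicator (c i ≟ β)
    colours i with rebalanced-view i
    ... | inj₁ (s , s′) = trans (selected-sum s′) (sym (selected-sum s))
    ... | inj₂ (_ , eq) = cong (λ j → indicator (j ≟ α) + indicator (j ≟ β)) eq
    pointwise : ∀ i → term rebalanced α i + term rebalanced β i ≡ term c α i + term c β i
    pointwise i = begin
      term rebalanced α i + term rebalanced β i
        ≡⟨ *-distribʳ-+ (incidence p q i v) (indicator (rebalanced i ≟ α)) _ ⟨
      (indicator (rebalanced i ≟ α) + indicator (rebalanced i ≟ β)) * incidence p q i v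
        ≡⟨ cong (_* incidence p q i v) (colours i) ⟩
      (indicator (c i ≟ α) + indicator (c i ≟ β)) * incidence p q i v
        ≡⟨ *-distribʳ-+ (incidence p q i v) (indicator (c i ≟ α)) _ ⟩
      term c α i + term c β i
        ∎

  rebalanced-other : ∀ {j} → j ≢ α → j ≢ β → ∀ v →
                     countAt p q rebalanced j v ≡ countAt p q c j v
  rebalanced-other {j} j≢α j≢β v = sum-cong-≗ λ i → cong (_* incidence p q i v) (colour i)
    where
    other : ∀ {k} → Selected k → k ≢ j
    other (inj₁ k≡α) k≡j = j≢α (trans (sym k≡j) k≡α)
    other (inj₂ k≡β) k≡j = j≢β (trans (sym k≡j) k≡β)
    colour : ∀ i → indicator (rebalanced i ≟ j) ≡ indicator (c i ≟ j)
    colour i with rebalanced-view i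
    ... | inj₁ (s , s′) = trans (indicator-false (rebalanced i ≟ j) (other s′))
                                (sym (indicator-false (c i ≟ j) (other s)))
    ... | inj₂ (_ , eq) = cong (λ k → indicator (k ≟ j)) eq

  paint-difference : ∀ s → + indicator (paint s ≟ α) ≡ + indicator (paint s ≟ β) ℤ.+ ⟦ s ⟧
  paint-difference Sign.+ rewrite indicator-true (α ≟ α) refl | indicator-false (α ≟ β) α≢β = refl
  paint-difference Sign.- rewrite indicator-true (β ≟ β) refl
                                | indicator-false (β ≟ α) (α≢β ∘ sym) = refl

  δ-sign : ∀ u v → ⟦ χ u ⟧ ℤ.* δ u v ≡ ⟦ χ v ⟧ ℤ.* δ u v
  δ-sign u v with u ≟ v
  ... | yes u≡v = cong (λ w → ⟦ χ w ⟧ ℤ.* + 1) u≡v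
  ... | no _    = trans (ℤ.*-zeroʳ ⟦ χ u ⟧) (sym (ℤ.*-zeroʳ ⟦ χ v ⟧))

  -- The ends have opposite signs, so the sum of the two indicators is a difference of signed ones;
  -- each of these vanishes unless its end is `v`, so its sign may be replaced by that of `v`.
  signed-incidence : ∀ i v → ⟦ χ (p i) ⟧ ℤ.* + incidence p q i v ≡ ⟦ χ v ⟧ ℤ.* ∂ (p i) (q i) v
  signed-incidence i v = begin
    ⟦ χ (p i) ⟧ ℤ.* (δ (p i) v ℤ.+ δ (q i) v)
      ≡⟨ expand ⟦ χ (p i) ⟧ (δ (p i) v) (δ (q i) v) ⟩
    ⟦ χ (p i) ⟧ ℤ.* δ (p i) v ℤ.- (ℤ.- ⟦ χ (p i) ⟧) ℤ.* δ (q i) v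
      ≡⟨ cong (λ z → ⟦ χ (p i) ⟧ ℤ.* δ (p i) v ℤ.- z ℤ.* δ (q i) v)
           (trans (cong ⟦_⟧ (proper i)) (⟦opposite⟧ (χ (p i)))) ⟨
    ⟦ χ (p i) ⟧ ℤ.* δ (p i) v ℤ.- ⟦ χ (q i) ⟧ ℤ.* δ (q i) v
      ≡⟨ cong₂ ℤ._-_ (δ-sign (p i) v) (δ-sign (q i) v) ⟩
    ⟦ χ v ⟧ ℤ.* δ (p i) v ℤ.- ⟦ χ v ⟧ ℤ.* δ (q i) v
      ≡⟨ collect ⟦ χ v ⟧ (δ (p i) v) (δ (q i) v) ⟩
    ⟦ χ v ⟧ ℤ.* ∂ (p i) (q i) v
      ∎
    where
    open ≡-Reasoning
    expand : ∀ s a b → s ℤ.* (a ℤ.+ b) ≡ s ℤ.* a ℤ.- (ℤ.- s) ℤ.* b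
    expand = ℤ-solve-∀
    collect : ∀ s a b → s ℤ.* a ℤ.- s ℤ.* b ≡ s ℤ.* (a ℤ.- b)
    collect = ℤ-solve-∀

  -- On the positive side the selected edges coloured `α` leave `v` and those coloured `β` enter it;
  -- on the negative side it is the other way round. So the counts differ by the net degree up to
  -- the sign of `v`.
  rebalanced-difference : ∀ v →
    + countAt p q rebalanced α v ≡
    + countAt p q rebalanced β v ℤ.+ ⟦ χ v ⟧ ℤ.* net σ tailEnd q v
  rebalanced-difference v = begin
    + sum (term α)                                      ≡⟨ +-sum (term α) ⟩
    ℤ-sum (+_ ∘ term α)
      ≡⟨ ℤ-Sum.sum-cong-≗ (λ i → pointwise i (selected? (c i))) ⟩
    ℤ-sum (λ i → + term β i ℤ.+ ⟦ χ v ⟧ ℤ.* flow i)     ≡⟨ ℤ-Sum.∑-distrib-+ (+_ ∘ term β) _ ⟩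
    ℤ-sum (+_ ∘ term β) ℤ.+ ℤ-sum (λ i → ⟦ χ v ⟧ ℤ.* flow i)
      ≡⟨ cong₂ ℤ._+_ (+-sum (term β)) (ℤ-Sum.*-distribˡ-sum ⟦ χ v ⟧ flow) ⟨
    + sum (term β) ℤ.+ ⟦ χ v ⟧ ℤ.* ℤ-sum flow           ∎
    where
    open ≡-Reasoning
    term : Fin m → Fin e → ℕ
    term j i = indicator (rebalanced i ≟ j) * incidence p q i v
    flow : Fin e → ℤ
    flow i = ⟦ σ i ⟧ ℤ.* ∂ (tailEnd i) (q i) v
    -- The new colour and the tail end both branch on `selected? (c i)`; with the decision as an
    -- argument, one match reduces both.
    pointwise : ∀ i (s? : Dec (Selected (c i))) →
      let colour = if does s? then paint (σ i Data.Sign.* χ (p i)) else c i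
          t      = if does s? then p i else q i in
      + (indicator (colour ≟ α) * incidence p q i v) ≡
      + (indicator (colour ≟ β) * incidence p q i v) ℤ.+ ⟦ χ v ⟧ ℤ.* (⟦ σ i ⟧ ℤ.* ∂ t (q i) v)
    pointwise i (yes _) = begin
      + (indicator (paint s ≟ α) * ι)
        ≡⟨ ℤ.pos-* (indicator (paint s ≟ α)) ι ⟩
      + indicator (paint s ≟ α) ℤ.* + ι
        ≡⟨ cong (ℤ._* + ι) (paint-difference s) ⟩
      (+ indicator (paint s ≟ β) ℤ.+ ⟦ s ⟧) ℤ.* + ι
        ≡⟨ ℤ.*-distribʳ-+ (+ ι) (+ indicator (paint s ≟ β)) ⟦ s ⟧ ⟩
      + indicator (paint s ≟ β) ℤ.* + ι ℤ.+ ⟦ s ⟧ ℤ.* + ι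
        ≡⟨ cong₂ ℤ._+_ (sym (ℤ.pos-* (indicator (paint s ≟ β)) ι)) flow≡ ⟩
      + (indicator (paint s ≟ β) * ι) ℤ.+ ⟦ χ v ⟧ ℤ.* (⟦ σ i ⟧ ℤ.* ∂ (p i) (q i) v)
        ∎
      where
      s = σ i Data.Sign.* χ (p i)
      ι = incidence p q i v
      flow≡ : ⟦ s ⟧ ℤ.* + ι ≡ ⟦ χ v ⟧ ℤ.* (⟦ σ i ⟧ ℤ.* ∂ (p i) (q i) v)
      flow≡ = begin
        ⟦ s ⟧ ℤ.* + ι                                 ≡⟨ cong (ℤ._* + ι) (⟦*⟧ (σ i) (χ (p i))) ⟩
        ⟦ σ i ⟧ ℤ.* ⟦ χ (p i) ⟧ ℤ.* + ι               ≡⟨ ℤ.*-assoc ⟦ σ i ⟧ ⟦ χ (p i) ⟧ (+ ι) ⟩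
        ⟦ σ i ⟧ ℤ.* (⟦ χ (p i) ⟧ ℤ.* + ι)
          ≡⟨ cong (λ z → ⟦ σ i ⟧ ℤ.* z) (signed-incidence i v) ⟩
        ⟦ σ i ⟧ ℤ.* (⟦ χ v ⟧ ℤ.* ∂ (p i) (q i) v)     ≡⟨ swap ⟦ σ i ⟧ ⟦ χ v ⟧ (∂ (p i) (q i) v) ⟩
        ⟦ χ v ⟧ ℤ.* (⟦ σ i ⟧ ℤ.* ∂ (p i) (q i) v)     ∎
        where
        swap : ∀ x y z → x ℤ.* (y ℤ.* z) ≡ y ℤ.* (x ℤ.* z)
        swap = ℤ-solve-∀
    -- An edge that is not selected has neither colour, and the loop standing for it carries no
    -- flow.
    pointwise i (no ¬s) = begin
      + (indicator (c i ≟ α) * ι)            ≡⟨ cong (λ x → + (x * ι)) colours ⟩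
      + (indicator (c i ≟ β) * ι)
        ≡⟨ loop (+ (indicator (c i ≟ β) * ι)) ⟦ χ v ⟧ ⟦ σ i ⟧ (δ (q i) v) ⟩
      + (indicator (c i ≟ β) * ι) ℤ.+ ⟦ χ v ⟧ ℤ.* (⟦ σ i ⟧ ℤ.* ∂ (q i) (q i) v) ∎
      where
      ι = incidence p q i v
      colours : indicator (c i ≟ α) ≡ indicator (c i ≟ β)
      colours = trans (indicator-false (c i ≟ α) (¬s ∘ inj₁))
                      (sym (indicator-false (c i ≟ β) (¬s ∘ inj₂)))
      loop : ∀ a x y z → a ≡ a ℤ.+ x ℤ.* (y ℤ.* (z ℤ.- z))
      loop = ℤ-solve-∀

  rebalanced-close : ∀ v → countAt p q rebalanced α v ≤ suc (countAt p q rebalanced β v) ×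
                           countAt p q rebalanced β v ≤ suc (countAt p q rebalanced α v)
  rebalanced-close v = close-from-difference (⟦ χ v ⟧ ℤ.* net σ tailEnd q v)
    (rebalanced-difference v)
    (subst (_≤ 1) (sym abs≡) (proj₂ (orientation tailEnd q) v))
    where
    open ≡-Reasoning
    abs≡ : ℤ.∣ ⟦ χ v ⟧ ℤ.* net σ tailEnd q v ∣ ≡ ℤ.∣ net σ tailEnd q v ∣
    abs≡ = begin
      ℤ.∣ ⟦ χ v ⟧ ℤ.* net σ tailEnd q v ∣        ≡⟨ ℤ.abs-* ⟦ χ v ⟧ (net σ tailEnd q v) ⟩
      ℤ.∣ ⟦ χ v ⟧ ∣ * ℤ.∣ net σ tailEnd q v ∣
        ≡⟨ cong (_* ℤ.∣ net σ tailEnd q v ∣) (ℤ.abs-◃ (χ v) 1) ⟩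
      1 * ℤ.∣ net σ tailEnd q v ∣                ≡⟨ *-identityˡ _ ⟩
      ℤ.∣ net σ tailEnd q v ∣                    ∎

-- Equitable colourings within prescribed groups of colours.

balanced-upper : ∀ {x y z} → x ≤ suc y → x + y ≤ suc z + suc z → x ≤ suc z
balanced-upper {x} {y} {z} x≤1+y x+y≤ with x ≤? suc z
... | yes x≤ = x≤
-- If `x` exceeds `suc z`, then `y` is at least `suc z`, and the total is too large.
... | no x≰  = contradiction x+y≤ (<⇒≱ (+-mono-<-≤ z+1<x (s≤s⁻¹ (≤-trans z+1<x x≤1+y))))
  where
  z+1<x : suc z < x
  z+1<x = ≰⇒> x≰

balanced-lower : ∀ {x y z} → y ≤ suc x → z + z ≤ suc x + suc y → z ≤ suc x
balanced-lower {x} {y} {z} y≤1+x z+z≤ with z ≤? suc x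
... | yes z≤ = z≤
-- If `suc x` is below `z`, then `suc y` is at most `z`, and the total is too small.
... | no z≰  = contradiction z+z≤ (<⇒≱ (+-mono-<-≤ (≰⇒> z≰) (≤-trans (s≤s y≤1+x) (≰⇒> z≰))))

-- No two values in a group differ by more than one, so a value below `f j₀` is already the least;
-- if there is none, `f j₀` is.
minimum-in-group : ∀ {m b} (γ : Fin m → Fin b) (f : Fin m → ℕ) →
  (∀ {j k} → γ j ≡ γ k → f j ≤ suc (f k)) →
  ∀ j₀ → ∃[ j ] γ j ≡ γ j₀ × (∀ k → γ k ≡ γ j₀ → f j ≤ f k)
minimum-in-group γ f close j₀ with any? (λ j → (γ j ≟ γ j₀) ×-dec (f j <? f j₀))
... | yes (j , γj , fj<) = j , γj , λ k γk → s≤s⁻¹ (≤-trans fj< (close (sym γk)))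
... | no none = j₀ , refl , λ k γk → ≮⇒≥ λ fk< → none (k , γk , fk<)

-- Since `j` and `k` may be exchanged, the one inequality bounds the difference in both directions.
Equitable : ∀ {n e m b} (γ : Fin m → Fin b) (p q : Fin e → Fin n) → (Fin e → Fin m) → Set
Equitable γ p q c = ∀ v {j k} → γ j ≡ γ k → countAt p q c j v ≤ suc (countAt p q c k v)

incidence-view : ∀ {n e} (p q : Fin e → Fin n) {i} → p i ≢ q i → ∀ v →
  incidence p q i v ≡ 0 ⊎ incidence p q i v ≡ 1 × (p i ≡ v ⊎ q i ≡ v)
incidence-view p q {i} p≢q v with p i ≟ v | q i ≟ v
... | yes p≡v | yes q≡v = contradiction (trans p≡v (sym q≡v)) p≢q
... | yes p≡v | no _    = inj₂ (refl , inj₁ p≡v)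
... | no _    | yes q≡v = inj₂ (refl , inj₂ q≡v)
... | no _    | no _    = inj₁ refl

extend : ∀ {e m} → Fin m → (Fin e → Fin m) → Fin (suc e) → Fin m
extend α c zero    = α
extend α c (suc i) = c i

module AddEdge {n e m b : ℕ} (γ : Fin m → Fin b) (p q : Fin (suc e) → Fin n)
  (χ : Fin n → Sign) (proper : ∀ i → χ (q i) ≡ opposite (χ (p i)))
  (c : Fin e → Fin m) (equitable : Equitable γ (tail p) (tail q) c)
  {α β : Fin m} (γα≡γβ : γ α ≡ γ β)
  (α-minimum : ∀ k → γ k ≡ γ α →
    countAt (tail p) (tail q) c α (p zero) ≤ countAt (tail p) (tail q) c k (p zero))
  (β-minimum : ∀ k → γ k ≡ γ α →
    countAt (tail p) (tail q) c β (q zero) ≤ countAt (tail p) (tail q) c k (q zero)) where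

  private
    old : Fin m → Fin n → ℕ
    old = countAt (tail p) (tail q) c

    c⁺ : Fin (suc e) → Fin m
    c⁺ = extend α c

    new : Fin m → Fin n → ℕ
    new = countAt p q c⁺

    ι : Fin n → ℕ
    ι = incidence p q zero

    opposite-fixpoint-free : ∀ s → s ≢ opposite s
    opposite-fixpoint-free Sign.+ ()
    opposite-fixpoint-free Sign.- ()

    new-edge-at : ∀ v → ι v ≡ 0 ⊎ ι v ≡ 1 × (p zero ≡ v ⊎ q zero ≡ v)
    new-edge-at = incidence-view p q λ p≡q →
      opposite-fixpoint-free (χ (p zero)) (trans (cong χ p≡q) (proper zero))

    new-α : ∀ v → new α v ≡ ι v + old α v
    new-α v = cong (_+ old α v)
      (trans (cong (_* ι v) (indicator-true (α ≟ α) refl)) (*-identityˡ (ι v)))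

    new-other : ∀ {j} → j ≢ α → ∀ v → new j v ≡ old j v
    new-other {j} j≢α v = cong (λ x → x * ι v + old j v) (indicator-false (α ≟ j) (j≢α ∘ sym))

  -- A colour rarest at both ends of the new edge can take it: a least count raised by one exceeds
  -- no other count by more than one.
  direct : α ≡ β → Equitable γ p q c⁺
  direct α≡β v {j} {k} γj≡γk with j ≟ α
  ... | no j≢α = begin
    new j v          ≡⟨ new-other j≢α v ⟩
    old j v          ≤⟨ equitable v γj≡γk ⟩
    suc (old k v)    ≤⟨ s≤s (m≤n+m (old k v) _) ⟩
    suc (new k v)    ∎
    where open ≤-Reasoning
  ... | yes refl = begin
    new α v          ≡⟨ new-α v ⟩
    ι v + old α v    ≤⟨ bound (new-edge-at v) ⟩
    suc (old k v)    ≤⟨ s≤s (m≤n+m (old k v) _) ⟩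
    suc (new k v)    ∎
    where
    open ≤-Reasoning
    bound : ι v ≡ 0 ⊎ ι v ≡ 1 × (p zero ≡ v ⊎ q zero ≡ v) → ι v + old α v ≤ suc (old k v)
    bound (inj₁ ι≡0) =
      subst (λ x → x + old α v ≤ suc (old k v)) (sym ι≡0) (equitable v γj≡γk)
    bound (inj₂ (ι≡1 , inj₁ refl)) =
      subst (λ x → x + old α v ≤ suc (old k v)) (sym ι≡1) (s≤s (α-minimum k (sym γj≡γk)))
    bound (inj₂ (ι≡1 , inj₂ refl)) =
      subst (λ x → x + old α v ≤ suc (old k v)) (sym ι≡1)
        (s≤s (subst (λ a → old a v ≤ old k v) (sym α≡β) (β-minimum k (sym γj≡γk))))

  module _ (α≢β : α ≢ β) where
    open Rebalance p q χ proper c⁺ α≢β public using (rebalanced; rebalanced-view)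
    open Rebalance p q χ proper c⁺ α≢β hiding (rebalanced; rebalanced-view)

    private
      final : Fin m → Fin n → ℕ
      final = countAt p q rebalanced

      total : ∀ v → final α v + final β v ≡ ι v + (old α v + old β v)
      total v = trans (rebalanced-total v)
        (trans (cong₂ _+_ (new-α v) (new-other (α≢β ∘ sym) v)) (+-assoc (ι v) _ _))

      final-other : ∀ {k} → k ≢ α → k ≢ β → ∀ v → final k v ≡ old k v
      final-other k≢α k≢β v = trans (rebalanced-other k≢α k≢β v) (new-other k≢α v)

      -- Away from the new edge both old counts are at most `suc (old k v)`. Its extra one is
      -- absorbed at `p zero` by the minimality of `α` and at `q zero` by that of `β`.
      total-upper : ∀ {k} v → γ k ≡ γ α → final α v + final β v ≤ suc (old k v) + suc (old k v)
      total-upper {k} v γk = ≤-trans (≤-reflexive (total v)) (bound (new-edge-at v))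
        where
        α≤ : old α v ≤ suc (old k v)
        α≤ = equitable v (sym γk)
        β≤ : old β v ≤ suc (old k v)
        β≤ = equitable v (trans (sym γα≡γβ) (sym γk))
        Bounded : ℕ → Set
        Bounded x = x + (old α v + old β v) ≤ suc (old k v) + suc (old k v)
        bound : ι v ≡ 0 ⊎ ι v ≡ 1 × (p zero ≡ v ⊎ q zero ≡ v) →
                ι v + (old α v + old β v) ≤ suc (old k v) + suc (old k v)
        bound (inj₁ ι≡0) = subst Bounded (sym ι≡0) (+-mono-≤ α≤ β≤)
        bound (inj₂ (ι≡1 , inj₁ refl)) = subst Bounded (sym ι≡1)
          (+-mono-≤ (s≤s (α-minimum k γk)) β≤)
        bound (inj₂ (ι≡1 , inj₂ refl)) = subst Bounded (sym ι≡1)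
          (≤-trans (≤-reflexive (sym (+-suc (old α v) (old β v))))
                   (+-mono-≤ α≤ (s≤s (β-minimum k γk))))

      -- The new edge can only raise the total, so the old inequalities suffice.
      total-lower : ∀ {k} v → γ k ≡ γ α → old k v + old k v ≤ suc (final α v) + suc (final β v)
      total-lower {k} v γk = begin
        old k v + old k v                       ≤⟨ +-mono-≤ (equitable v γk)
                                                            (equitable v (trans γk γα≡γβ)) ⟩
        suc (old α v) + suc (old β v)           ≡⟨ cong suc (+-suc (old α v) (old β v)) ⟩
        2 + (old α v + old β v)                 ≤⟨ +-monoʳ-≤ 2 (m≤n+m (old α v + old β v) (ι v)) ⟩
        2 + (ι v + (old α v + old β v))         ≡⟨ cong (λ x → 2 + x) (total v) ⟨
        2 + (final α v + final β v)             ≡⟨ cong suc (+-suc (final α v) (final β v)) ⟨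
        suc (final α v) + suc (final β v)       ∎
        where open ≤-Reasoning

      swap-≤ : ∀ {w} x y → w ≤ x + y → w ≤ y + x
      swap-≤ x y w≤ = ≤-trans w≤ (≤-reflexive (+-comm x y))

      swap-≥ : ∀ {w} x y → x + y ≤ w → y + x ≤ w
      swap-≥ x y = ≤-trans (≤-reflexive (+-comm y x))

      data Colour (j : Fin m) : Set where
        is-α  : j ≡ α → Colour j
        is-β  : j ≡ β → Colour j
        other : j ≢ α → j ≢ β → Colour j

      colour : ∀ j → Colour j
      colour j with j ≟ α | j ≟ β
      ... | yes j≡α | _       = is-α j≡α
      ... | no _    | yes j≡β = is-β j≡β
      ... | no j≢α  | no j≢β  = other j≢α j≢β

    -- The counts of `α` and `β` are now within one of each other, so bounds on their total compare
    -- each of them with any third colour of the group. Counts of third colours are unchanged.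
    rebalanced-equitable : Equitable γ p q rebalanced
    rebalanced-equitable v {j} {k} γj≡γk with rebalanced-close v | colour j | colour k
    ... | _         | is-α refl     | is-α refl     = n≤1+n _
    ... | α≤ , _    | is-α refl     | is-β refl     = α≤
    ... | _  , β≤   | is-β refl     | is-α refl     = β≤
    ... | _         | is-β refl     | is-β refl     = n≤1+n _
    ... | α≤ , _    | is-α refl     | other k≢α k≢β rewrite final-other k≢α k≢β v =
      balanced-upper α≤ (total-upper v (sym γj≡γk))
    ... | _  , β≤   | is-β refl     | other k≢α k≢β rewrite final-other k≢α k≢β v =
      balanced-upper β≤ (swap-≥ (final α v) _ (total-upper v (trans (sym γj≡γk) (sym γα≡γβ))))
    ... | _  , β≤   | other j≢α j≢β | is-α refl     rewrite final-other j≢α j≢β v =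
      balanced-lower β≤ (total-lower v γj≡γk)
    ... | α≤ , _    | other j≢α j≢β | is-β refl     rewrite final-other j≢α j≢β v =
      balanced-lower α≤ (swap-≤ (suc (final α v)) _ (total-lower v (trans γj≡γk (sym γα≡γβ))))
    ... | _         | other j≢α j≢β | other k≢α k≢β
      rewrite final-other j≢α j≢β v | final-other k≢α k≢β v = equitable v γj≡γk

equitable-colouring : ∀ {n e m b} (γ : Fin m → Fin b) → (∀ i → ∃[ j ] γ j ≡ i) →
  (p q : Fin e → Fin n) (χ : Fin n → Sign) → (∀ i → χ (q i) ≡ opposite (χ (p i))) →
  (h : Fin e → Fin b) → ∃[ c ] ((∀ i → γ (c i) ≡ h i) × Equitable γ p q c)
equitable-colouring {e = zero}  γ onto p q χ proper h = (λ ()) , (λ ()) , λ _ _ → z≤n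
equitable-colouring {e = suc e} γ onto p q χ proper h
  with c , γc , equitable ← equitable-colouring γ onto (tail p) (tail q) χ (proper ∘ suc) (tail h)
  -- Any colour of the group prescribed for the new edge starts the search for the rarest one at
  -- either end.
  with j₀ , γj₀ ← onto (h zero)
  with α , γα , α-min ← minimum-in-group γ (λ j → countAt (tail p) (tail q) c j (p zero))
                          (equitable (p zero)) j₀
  with β , γβ , β-min ← minimum-in-group γ (λ j → countAt (tail p) (tail q) c j (q zero))
                          (equitable (q zero)) j₀
  = by-cases (α ≟ β)
  where
  module Step = AddEdge γ p q χ proper c equitable (trans γα (sym γβ))
    (λ k γk → α-min k (trans γk γα)) (λ k γk → β-min k (trans γk γα))
  γc⁺ : ∀ i → γ (extend α c i) ≡ h i
  γc⁺ zero    = trans γα γj₀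
  γc⁺ (suc i) = γc i
  by-cases : Dec (α ≡ β) → ∃[ c ] ((∀ i → γ (c i) ≡ h i) × Equitable γ p q c)
  by-cases (yes α≡β) = extend α c , γc⁺ , Step.direct α≡β
  by-cases (no α≢β)  = Step.rebalanced α≢β , groups , Step.rebalanced-equitable α≢β
    where
    selected-group : ∀ {j} → j ≡ α ⊎ j ≡ β → γ j ≡ γ j₀
    selected-group (inj₁ refl) = γα
    selected-group (inj₂ refl) = γβ
    -- Recolouring exchanges only `α` and `β`, which lie in one group, so every edge keeps its
    -- prescribed group.
    groups : ∀ i → γ (Step.rebalanced α≢β i) ≡ h i
    groups i with Step.rebalanced-view α≢β i
    ... | inj₁ (s , s′) = trans (selected-group s′) (trans (sym (selected-group s)) (γc⁺ i))
    ... | inj₂ (_ , eq) = trans (cong γ eq) (γc⁺ i)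

-- Group sizes and averages over groups.

sum-mono-≤ : ∀ {n} {f g : Vector ℕ n} → (∀ i → f i ≤ g i) → sum f ≤ sum g
sum-mono-≤ {zero}  f≤g = z≤n
sum-mono-≤ {suc n} f≤g = +-mono-≤ (f≤g zero) (sum-mono-≤ (f≤g ∘ suc))

sum-mono-< : ∀ {n} {f g : Vector ℕ n} → (∀ i → f i ≤ g i) → ∀ i → f i < g i → sum f < sum g
sum-mono-< f≤g zero    fᵢ<gᵢ = +-mono-<-≤ fᵢ<gᵢ (sum-mono-≤ (f≤g ∘ suc))
sum-mono-< f≤g (suc i) fᵢ<gᵢ = +-mono-≤-< (f≤g zero) (sum-mono-< (f≤g ∘ suc) i fᵢ<gᵢ)

sum-ones : ∀ n → sum {n} (const 1) ≡ n
sum-ones zero    = refl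
sum-ones (suc n) = cong suc (sum-ones n)

sum-indicator : ∀ {n} x (f : Vector ℕ n) → sum (λ j → indicator (x ≟ j) * f j) ≡ f x
sum-indicator {suc n} zero f =
  trans (cong₂ _+_ (*-identityˡ (f zero)) (sum-replicate-zero n)) (+-identityʳ (f zero))
sum-indicator (suc x) f = sum-indicator x (tail f)

groupSize : ∀ {m b} → (Fin m → Fin b) → Fin b → ℕ
groupSize γ i = sum λ j → indicator (γ j ≟ i)

groupSize≤m : ∀ {m b} (γ : Fin m → Fin b) i → groupSize γ i ≤ m
groupSize≤m {m} γ i = begin
  groupSize γ i                      ≤⟨ sum-mono-≤ (λ j → indicator≤1 (γ j ≟ i)) ⟩
  sum {m} (const 1)                  ≡⟨ sum-ones m ⟩
  m                                  ∎
  where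
  open ≤-Reasoning
  indicator≤1 : {P : Set} (P? : Dec P) → indicator P? ≤ 1
  indicator≤1 (yes _) = ≤-refl
  indicator≤1 (no _)  = z≤n

groupSize-positive : ∀ {m b} (γ : Fin m → Fin b) j → 0 < groupSize γ (γ j)
groupSize-positive {m} γ j = subst (_< groupSize γ (γ j)) (sum-replicate-zero m)
  (sum-mono-< {f = const 0} (λ _ → z≤n) j (≤-reflexive (sym (indicator-true (γ j ≟ γ j) refl))))

-- Double counting: every colour lies in exactly one group.
sum-groupSize : ∀ {m b} (γ : Fin m → Fin b) → sum (groupSize γ) ≡ m
sum-groupSize {m} {b} γ = begin
  sum (λ i → sum λ j → indicator (γ j ≟ i))    ≡⟨ ∑-comm (λ i j → indicator (γ j ≟ i)) ⟩
  sum (λ j → sum λ i → indicator (γ j ≟ i))    ≡⟨ sum-cong-≗ (λ j → sum-cong-≗ λ i →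
                                                   sym (*-identityʳ (indicator (γ j ≟ i)))) ⟩
  sum (λ j → sum λ i → indicator (γ j ≟ i) * 1)
    ≡⟨ sum-cong-≗ (λ j → sum-indicator (γ j) (const 1)) ⟩
  sum {m} (const 1)                             ≡⟨ sum-ones m ⟩
  m                                             ∎
  where
  open ≡-Reasoning

sum-tabulate : ∀ {n} (f : Vector ℕ n) → Vec.sum (Vec.tabulate f) ≡ sum f
sum-tabulate {zero}  f = refl
sum-tabulate {suc n} f = cong (_+_ (f zero)) (sum-tabulate (tail f))

module _ {m b} (γ : Fin m → Fin b) {f : Fin m → ℕ}
  (close : ∀ {j k} → γ j ≡ γ k → f j ≤ suc (f k)) where

  groupSum : Fin b → ℕ
  groupSum i = sum λ j → indicator (γ j ≟ i) * f j

  -- If `f k` were below `q`, closeness would keep the whole group at most `q`, and the strict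
  -- inequality at `k` would make the sum too small. The upper bound is dual.
  group-lower : ∀ k q → groupSize γ (γ k) * q ≤ groupSum (γ k) → q ≤ f k
  group-lower k q size*q≤ = ≮⇒≥ λ fk<q → <⇒≱ (deficit fk<q) size*q≤
    where
    deficit : f k < q → groupSum (γ k) < groupSize γ (γ k) * q
    deficit fk<q = subst (groupSum (γ k) <_)
      (sym (*-distribʳ-sum q (λ j → indicator (γ j ≟ γ k))))
      (sum-mono-< (λ j → term j (γ j ≟ γ k)) k
        (subst (λ x → x * f k < x * q) (sym (indicator-true (γ k ≟ γ k) refl)) (*-monoʳ-< 1 fk<q)))
      where
      term : ∀ j (γj? : Dec (γ j ≡ γ k)) → indicator γj? * f j ≤ indicator γj? * q
      term j (yes γj≡γk) = *-monoʳ-≤ 1 (≤-trans (close γj≡γk) fk<q)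
      term j (no _)      = z≤n

  group-upper : ∀ k q → groupSum (γ k) ≤ groupSize γ (γ k) * q → f k ≤ q
  group-upper k q ≤size*q = ≮⇒≥ λ q<fk → <⇒≱ (excess q<fk) ≤size*q
    where
    excess : q < f k → groupSize γ (γ k) * q < groupSum (γ k)
    excess q<fk = subst (_< groupSum (γ k))
      (sym (*-distribʳ-sum q (λ j → indicator (γ j ≟ γ k))))
      (sum-mono-< (λ j → term j (γ j ≟ γ k)) k
        (subst (λ x → x * q < x * f k) (sym (indicator-true (γ k ≟ γ k) refl)) (*-monoʳ-< 1 q<fk)))
      where
      term : ∀ j (γj? : Dec (γ j ≡ γ k)) → indicator γj? * q ≤ indicator γj? * f j
      term j (yes γj≡γk) = *-monoʳ-≤ 1 (s≤s⁻¹ (≤-trans q<fk (close (sym γj≡γk))))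
      term j (no _)      = z≤n

  group-exact : ∀ k q → groupSum (γ k) ≡ groupSize γ (γ k) * q → f k ≡ q
  group-exact k q eq =
    ≤-antisym (group-upper k q (≤-reflexive eq)) (group-lower k q (≤-reflexive (sym eq)))

-- After exchanging the sums, each edge is counted under its own colour only, and so contributes
-- precisely when that colour lies in group `i`.
groupSum-countAt : ∀ {n e m b} (γ : Fin m → Fin b) (p q : Fin e → Fin n) (c : Fin e → Fin m) i v →
  sum (λ j → indicator (γ j ≟ i) * countAt p q c j v) ≡ countAt p q (γ ∘ c) i v
groupSum-countAt {e = e} γ p q c i v = begin
  sum (λ j → g j * sum λ x → indicator (c x ≟ j) * ι x)
    ≡⟨ sum-cong-≗ (λ j → *-distribˡ-sum (g j) (λ x → indicator (c x ≟ j) * ι x)) ⟩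
  sum (λ j → sum λ x → g j * (indicator (c x ≟ j) * ι x))
    ≡⟨ ∑-comm (λ j x → g j * (indicator (c x ≟ j) * ι x)) ⟩
  sum (λ x → sum λ j → g j * (indicator (c x ≟ j) * ι x))
    ≡⟨ sum-cong-≗ (λ x → sum-cong-≗ λ j → rearrange (g j) (indicator (c x ≟ j)) (ι x)) ⟩
  sum (λ x → sum λ j → indicator (c x ≟ j) * (g j * ι x))
    ≡⟨ sum-cong-≗ (λ x → sum-indicator (c x) (λ j → g j * ι x)) ⟩
  sum (λ x → g (c x) * ι x)                                  ∎
  where
  open ≡-Reasoning
  g : _ → ℕ
  g j = indicator (γ j ≟ i)
  ι : Fin e → ℕ
  ι x = incidence p q x v
  rearrange : ∀ x y z → x * (y * z) ≡ y * (x * z)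
  rearrange x y z = trans (sym (*-assoc x y z)) (trans (cong (_* z) (*-comm x y)) (*-assoc y x z))

-- Edge subsets and degrees.

∈-tabulate⁻ : ∀ {n} {P : Fin n → Set} (P? : ∀ i → Dec (P i)) {i} →
              i ∈ Vec.tabulate (does ∘ P?) → P i
∈-tabulate⁻ P? {i} i∈ = holds (P? i)
  (trans (sym (Vec.lookup∘tabulate (does ∘ P?) i)) (Vec.[]=⇒lookup i∈))
  where
  holds : {P : Set} (P? : Dec P) → does P? ≡ true → P
  holds (yes p) _ = p

∈-tabulate⁺ : ∀ {n} {P : Fin n → Set} (P? : ∀ i → Dec (P i)) {i} →
              P i → i ∈ Vec.tabulate (does ∘ P?)
∈-tabulate⁺ P? {i} pᵢ = Vec.lookup⇒[]= i _
  (trans (Vec.lookup∘tabulate (does ∘ P?) i) (dec-true (P? i) pᵢ))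

x∈p─q⇒x∉q : ∀ {n} {x : Fin n} (p q : Subset n) → x ∈ p ─ q → x ∉ q
x∈p─q⇒x∉q (_ Vec.∷ p) (true Vec.∷ q)  () Vec.here
x∈p─q⇒x∉q (_ Vec.∷ p) (_ Vec.∷ q) (Vec.there x∈p─q) (Vec.there x∈q) = x∈p─q⇒x∉q p q x∈p─q x∈q

∣∣-positive : ∀ {n} (p : Subset n) → 0 < ∣ p ∣ → Nonempty p
∣∣-positive {n} p 0<∣p∣ with nonempty? p
... | yes nonempty = nonempty
... | no empty     = contradiction (subst (λ s → 0 < ∣ s ∣) (Empty-unique empty) 0<∣p∣)
                       (subst (λ k → ¬ 0 < k) (sym (∣⊥∣≡0 n)) λ ())

∣tabulate∩tabulate∣ : ∀ {n} (f g : Fin n → Bool) →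
  ∣ Vec.tabulate f ∩ Vec.tabulate g ∣ ≡
  sum λ i → (if f i then 1 else 0) * (if g i then 1 else 0)
∣tabulate∩tabulate∣ {zero}  f g = refl
∣tabulate∩tabulate∣ {suc n} f g with f zero | g zero
... | true  | true  = cong suc (∣tabulate∩tabulate∣ (f ∘ suc) (g ∘ suc))
... | true  | false = ∣tabulate∩tabulate∣ (f ∘ suc) (g ∘ suc)
... | false | _     = ∣tabulate∩tabulate∣ (f ∘ suc) (g ∘ suc)

module _ {n e} (G : Graph n e) where

  -- The two sides could differ only for an edge with both ends at `v`, which looplessness excludes.
  incidence≡indicator : ∀ i v → incidence (end₁ G) (end₂ G) i v ≡ indicator (incident? G i v)
  incidence≡indicator i v with end₁ G i ≟ v | end₂ G i ≟ v
  ... | yes p≡v | yes q≡v = contradiction (trans p≡v (sym q≡v)) (loopless G i)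
  ... | yes _   | no _    = refl
  ... | no _    | yes _   = refl
  ... | no _    | no _    = refl

  colourDegree≡countAt : ∀ {m} (c : Fin e → Fin m) j v →
                         colourDegree G c j v ≡ countAt (end₁ G) (end₂ G) c j v
  colourDegree≡countAt c j v = trans
    (∣tabulate∩tabulate∣ (λ i → does (c i ≟ j)) (λ i → does (incident? G i v)))
    (sum-cong-≗ λ i → cong (indicator (c i ≟ j) *_) (sym (incidence≡indicator i v)))

  edge-at : ∀ v → 0 < degree G v → ∃[ i ] Incident G i v
  edge-at v 0<d with i , i∈ ← ∣∣-positive (⊤ ∩ edgesAt G v) 0<d =
    i , ∈-tabulate⁻ (λ i → incident? G i v) (proj₂ (x∈p∩q⁻ ⊤ (edgesAt G v) i∈))

  -- Deleting all edges at `v` cuts it off from the other vertices, so there cannot be fewer than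
  -- `k` of them. The bound on the number of vertices provides `punchIn v zero`, a vertex other than
  -- `v`.
  minimum-degree : ∀ {k S} → EdgeConnectedIn G k S → ∀ v → k ≤ degreeIn G S v
  minimum-degree {k} {S} (s≤s (s≤s _) , connected) v = ≮⇒≥ λ d<k →
    no-way-out (punchInᵢ≢i v zero ∘ sym)
      (connected (S ∩ edgesAt G v) (p∩q⊆p S (edgesAt G v)) d<k v (punchIn v zero))
    where
    incident : ∀ {i w} → Joins G i v w → Incident G i v
    incident (inj₁ (end₁≡v , _)) = inj₁ end₁≡v
    incident (inj₂ (_ , end₂≡v)) = inj₂ end₂≡v
    no-way-out : ∀ {w} → v ≢ w → ¬ Star (AdjacentIn G (S ─ (S ∩ edgesAt G v))) v w
    no-way-out v≢v ε = v≢v refl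
    no-way-out _ ((i , i∈ , joins) ◅ _) = x∈p─q⇒x∉q S _ i∈
      (x∈p∩q⁺ (p─q⊆p S _ i∈ , ∈-tabulate⁺ (λ i → incident? G i v) (incident joins)))

-- Partition of the colours into groups.

injective⇒surjective : ∀ {m} (f : Fin m → Fin m) → Injective _≡_ _≡_ f → ∀ j → ∃[ i ] f i ≡ j
injective⇒surjective {suc m} f f-injective j with any? (λ i → f i ≟ j)
... | yes found = found
-- Punching out a missed value `j` would inject `Fin (suc m)` into `Fin m`.
... | no missed = contradiction
  (injective⇒≤ λ {x} {y} → f-injective ∘ punchOut-injective (j≢f x) (j≢f y)) 1+n≰n
  where
  j≢f : ∀ i → j ≢ f i
  j≢f i j≡fi = missed (i , sym j≡fi)

-- The fibres of `g`, numbered without gaps. Values of `g` are unsuitable as group labels: `endB`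
-- misses all vertices of the class `A`, whereas the decomposition needs every group size to be
-- positive.
record Kernel {m n} (g : Fin m → Fin n) : Set where
  field
    {size}   : ℕ
    class-of : Fin m → Fin size
    onto     : ∀ i → ∃[ j ] class-of j ≡ i
    sound    : ∀ {j k} → g j ≡ g k → class-of j ≡ class-of k
    faithful : ∀ {j k} → class-of j ≡ class-of k → g j ≡ g k

kernel : ∀ {m n} (g : Fin m → Fin n) → Kernel g
kernel {zero}  g = record
  { size = 0 ; class-of = λ () ; onto = λ () ; sound = λ { {()} } ; faithful = λ { {()} } }
kernel {suc m} g with kernel (g ∘ suc) | any? (λ j → g (suc j) ≟ g zero)
... | K | yes (j₀ , gj₀) = record
  { class-of = class-of⁺ ; onto = onto⁺
  ; sound = λ {j} {k} → sound⁺ j k ; faithful = λ {j} {k} → faithful⁺ j k }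
  where
  open Kernel K
  class-of⁺ : Fin (suc m) → Fin size
  class-of⁺ zero    = class-of j₀
  class-of⁺ (suc j) = class-of j
  onto⁺ : ∀ i → ∃[ j ] class-of⁺ j ≡ i
  onto⁺ i with j , eq ← onto i = suc j , eq
  sound⁺ : ∀ j k → g j ≡ g k → class-of⁺ j ≡ class-of⁺ k
  sound⁺ zero    zero    _  = refl
  sound⁺ zero    (suc k) eq = sound (trans gj₀ eq)
  sound⁺ (suc j) zero    eq = sound (trans eq (sym gj₀))
  sound⁺ (suc j) (suc k) eq = sound eq
  faithful⁺ : ∀ j k → class-of⁺ j ≡ class-of⁺ k → g j ≡ g k
  faithful⁺ zero    zero    _  = refl
  faithful⁺ zero    (suc k) eq = trans (sym gj₀) (faithful eq)
  faithful⁺ (suc j) zero    eq = trans (faithful eq) gj₀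
  faithful⁺ (suc j) (suc k) eq = faithful eq
-- The value at `zero` is new, so it opens a class of its own and the old labels shift by one.
... | K | no fresh = record
  { class-of = class-of⁺ ; onto = onto⁺
  ; sound = λ {j} {k} → sound⁺ j k ; faithful = λ {j} {k} → faithful⁺ j k }
  where
  open Kernel K
  class-of⁺ : Fin (suc m) → Fin (suc size)
  class-of⁺ zero    = zero
  class-of⁺ (suc j) = suc (class-of j)
  onto⁺ : ∀ i → ∃[ j ] class-of⁺ j ≡ i
  onto⁺ zero    = zero , refl
  onto⁺ (suc i) with j , eq ← onto i = suc j , cong suc eq
  sound⁺ : ∀ j k → g j ≡ g k → class-of⁺ j ≡ class-of⁺ k
  sound⁺ zero    zero    _  = refl
  sound⁺ zero    (suc k) eq = contradiction (k , sym eq) fresh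
  sound⁺ (suc j) zero    eq = contradiction (j , eq) fresh
  sound⁺ (suc j) (suc k) eq = cong suc (sound eq)
  faithful⁺ : ∀ j k → class-of⁺ j ≡ class-of⁺ k → g j ≡ g k
  faithful⁺ zero    zero    _  = refl
  faithful⁺ (suc j) (suc k) eq = faithful (suc-injective eq)

transpose-source : ∀ {n} (i j : Fin n) → transpose i j i ≡ j
transpose-source i j rewrite dec-true (i ≟ i) refl = refl

-- A transposition of labels puts the class of `j₀` last, at the one index that `degree-B` does not
-- cover. Every other class then has a label `inject₁ i`.
grouping : ∀ {m n} (g : Fin m → Fin n) j₀ →
  ∃[ b ] ∃[ γ ] ((∀ (i : Fin (suc b)) → ∃[ j ] γ j ≡ i) ×
                 (∀ {j k} → g j ≡ g k → γ j ≡ γ k) ×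
                 (∀ {j} → g j ≢ g j₀ → ∃[ i ] γ j ≡ inject₁ i))
grouping {m} g j₀ with kernel g
... | record { size = zero ; class-of = class-of } = contradiction (class-of j₀) λ ()
... | record { size = suc b ; class-of = class-of ; onto = onto
             ; sound = sound ; faithful = faithful }
  = b , γ , γ-onto , cong swap ∘ sound , avoids-last
  where
  swap swap⁻¹ : Fin (suc b) → Fin (suc b)
  swap   = transpose (class-of j₀) (fromℕ b)
  swap⁻¹ = transpose (fromℕ b) (class-of j₀)
  γ : Fin m → Fin (suc b)
  γ = swap ∘ class-of
  γ-onto : ∀ i → ∃[ j ] γ j ≡ i
  γ-onto i with j , eq ← onto (swap⁻¹ i) =
    j , trans (cong swap eq) (transpose-inverse (class-of j₀) (fromℕ b))
  avoids-last : ∀ {j} → g j ≢ g j₀ → ∃[ i ] γ j ≡ inject₁ i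
  avoids-last {j} gj≢ with γ j in γj≡ | view (γ j)
  -- Undoing the transposition at the last label leads back to the class of `j₀`.
  ... | _ | ‵fromℕ = contradiction (faithful (begin
    class-of j                   ≡⟨ transpose-inverse (fromℕ b) (class-of j₀) ⟨
    swap⁻¹ (γ j)                 ≡⟨ cong swap⁻¹ γj≡ ⟩
    swap⁻¹ (fromℕ b)             ≡⟨ transpose-source (fromℕ b) (class-of j₀) ⟩
    class-of j₀                  ∎)) gj≢
    where open ≡-Reasoning
  ... | _ | ‵inject₁ i = i , refl

-- Ends of tree edges and the `T`-equitable colouring.

sign : Class → Sign
sign A = Sign.+
sign B = Sign.-

sign-opposite : ∀ {X Y} → X ≢ Y → sign Y ≡ opposite (sign X)
sign-opposite {A} {A} X≢Y = contradiction refl X≢Y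
sign-opposite {A} {B} _   = refl
sign-opposite {B} {A} _   = refl
sign-opposite {B} {B} X≢Y = contradiction refl X≢Y

module _ {n m} (T : Graph n m) (P : Bipartition T) where

  end-in-B : ∀ e → ∃[ t ] (Incident T e t × class P t ≡ B)
  end-in-B e with class P (end₁ T e) in eq₁ | class P (end₂ T e) in eq₂
  ... | B | _ = end₁ T e , inj₁ refl , eq₁
  ... | A | B = end₂ T e , inj₂ refl , eq₂
  ... | A | A = contradiction (trans eq₁ (sym eq₂)) (proper P e)

  same-class-end : ∀ {e t t′} → Incident T e t → Incident T e t′ → class P t ≡ class P t′ → t ≡ t′
  same-class-end (inj₁ refl) (inj₁ refl) _  = refl
  same-class-end (inj₁ refl) (inj₂ refl) eq = contradiction eq (proper P _)
  same-class-end (inj₂ refl) (inj₁ refl) eq = contradiction (sym eq) (proper P _)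
  same-class-end (inj₂ refl) (inj₂ refl) _  = refl

theorem14 : ∀ {nT m} (T : Graph nT m) → IsTree T →
    (P : Bipartition T) → (∃[ t ] (class P t ≡ B × Leaf T t)) →
    (κ : Fin m → Fin m) → Injective _≡_ _≡_ κ →
    (f : ℕ → ℕ → ℕ) → DecompositionProperty f →
    (d : ℕ) → ∀ {n e} (G : Graph n e) (Q : Bipartition G) →
    (∀ v → class Q v ≡ A → m ∣ degree G v) →
    EdgeConnected G (f m (m * d)) →
    ∃[ c ] (TEquitable T P κ G Q c × (∀ v j → d ≤ colourDegree G c j v))
theorem14 {nT} {m} T _ P (t₀ , t₀∈B , leaf) κ κ-injective f decompose
          d {n} {e} G Q m∣degree connected
  -- The colour of the edge at the leaf determines which group comes last.
  with e₀ , e₀-at-t₀ ← edge-at T t₀ (≤-reflexive (sym leaf))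
  = colouring
  where
  -- An injective `κ` is a bijection, so every colour belongs to one tree edge, whose end in the
  -- class `B` determines the group.
  endB : Fin m → Fin nT
  endB j = proj₁ (end-in-B T P (proj₁ (injective⇒surjective κ κ-injective j)))

  endB-unique : ∀ {t j} → class P t ≡ B → ColourAt T κ t j → endB j ≡ t
  endB-unique {t} {j} t∈B (e , e-at-t , κe≡j)
    with e′ , κe′≡j ← injective⇒surjective κ κ-injective j
    with refl ← κ-injective (trans κe≡j (sym κe′≡j))
    with t′ , e-at-t′ , t′∈B ← end-in-B T P e
    = same-class-end T P e-at-t′ e-at-t (trans t′∈B (sym t∈B))

  j₀ : Fin m
  j₀ = κ e₀

  colouring : ∃[ c ] (TEquitable T P κ G Q c × (∀ v j → d ≤ colourDegree G c j v))
  colouring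
    with b , γ , γ-onto , γ-sound , γ-avoids ← grouping endB j₀
    -- The parts have the group sizes as their `ms`; these are positive because no group is empty.
    -- Connectivity `m * d` is requested for the lower bound `d` on colour degrees.
    with h , decomposition ← decompose m (m * d) b (Vec.tabulate (groupSize γ))
           (λ i → subst (0 <_) (sym (Vec.lookup∘tabulate (groupSize γ) i))
                    (subst (λ i → 0 < groupSize γ i) (proj₂ (γ-onto i))
                      (groupSize-positive γ (proj₁ (γ-onto i)))))
           (sym (trans (sum-tabulate (groupSize γ)) (sum-groupSize γ)))
           G Q connected m∣degree
    with c , γc≡h , equitable ← equitable-colouring γ γ-onto (end₁ G) (end₂ G) (sign ∘ class Q)
           (λ i → sign-opposite (proper Q i)) h
    = c , T-equitable , at-least-d
    where
    open Decomposes decomposition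

    count : Fin m → Fin n → ℕ
    count = countAt (end₁ G) (end₂ G) c

    groupDegree : Fin (suc b) → Fin n → ℕ
    groupDegree i = degreeIn G (colourClass h i)

    size≡ : ∀ i → Vec.lookup (Vec.tabulate (groupSize γ)) i ≡ groupSize γ i
    size≡ = Vec.lookup∘tabulate (groupSize γ)

    groupSum≡ : ∀ i v → groupSum γ {λ j → count j v} (equitable v) i ≡ groupDegree i v
    groupSum≡ i v = begin
      sum (λ j → indicator (γ j ≟ i) * count j v)    ≡⟨ groupSum-countAt γ (end₁ G) (end₂ G) c i v ⟩
      countAt (end₁ G) (end₂ G) (γ ∘ c) i v
        ≡⟨ sum-cong-≗ (λ x → cong (λ k → indicator (k ≟ i) * incidence (end₁ G) (end₂ G) x v)
                                  (γc≡h x)) ⟩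
      countAt (end₁ G) (end₂ G) h i v                ≡⟨ colourDegree≡countAt G h i v ⟨
      groupDegree i v                                ∎
      where open ≡-Reasoning

    exact : ∀ j v q → groupDegree (γ j) v ≡ groupSize γ (γ j) * q → colourDegree G c j v ≡ q
    exact j v q eq = trans (colourDegree≡countAt G c j v)
      (group-exact γ (equitable v) j q (trans (groupSum≡ (γ j) v) eq))

    exact-A : ∀ v → class Q v ≡ A → ∃[ q ] (∀ j → colourDegree G c j v ≡ q)
    -- The quotient of the degree of `v` by `m` is the same for all groups, so all colours agree at
    -- `v`. Cancelling `m` is possible as `j₀` shows it to be nonzero.
    exact-A v v∈A with divides q degree≡ ← m∣degree v v∈A = q , λ j → exact j v q
      (*-cancelˡ-≡ _ _ m ⦃ nonZeroIndex j₀ ⦄ (begin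
        m * groupDegree (γ j) v              ≡⟨ degree-A v v∈A (γ j) ⟩
        Vec.lookup (Vec.tabulate (groupSize γ)) (γ j) * degree G v
                                             ≡⟨ cong₂ _*_ (size≡ (γ j)) degree≡ ⟩
        groupSize γ (γ j) * (q * m)          ≡⟨ *-assoc (groupSize γ (γ j)) q m ⟨
        groupSize γ (γ j) * q * m            ≡⟨ *-comm _ m ⟩
        m * (groupSize γ (γ j) * q)          ∎))
      where open ≡-Reasoning

    exact-B : ∀ v → class Q v ≡ B → ∀ i →
              ∃[ q ] (∀ j → γ j ≡ inject₁ i → colourDegree G c j v ≡ q)
    exact-B v v∈B i with divides q eq ← degree-B v v∈B i = q , λ j γj≡i → exact j v q
      (subst (λ i → groupDegree i v ≡ groupSize γ i * q) (sym γj≡i)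
        (trans eq (trans (cong (q *_) (size≡ (inject₁ i))) (*-comm q _))))

    T-equitable : TEquitable T P κ G Q c
    T-equitable A v v∈A t t∈A _ j k _ _ with q , eq ← exact-A v v∈A = trans (eq j) (sym (eq k))
    T-equitable B v v∈B t t∈B nonleaf j k j-at-t k-at-t
      -- If `endB j` and `endB j₀` coincided, then `t` would be the leaf `t₀`. Hence the group of
      -- `j` is not the last one and `degree-B` applies to it.
      with i , γj≡i ← γ-avoids {j} (λ endB≡ → nonleaf (subst (Leaf T)
             (trans (sym (endB-unique t₀∈B (e₀ , e₀-at-t₀ , refl)))
                    (trans (sym endB≡) (endB-unique t∈B j-at-t))) leaf))
      with q , eq ← exact-B v v∈B i
      = trans (eq j γj≡i) (sym (eq k (trans (γ-sound
          (trans (endB-unique t∈B k-at-t) (sym (endB-unique t∈B j-at-t)))) γj≡i)))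

    at-least-d : ∀ v j → d ≤ colourDegree G c j v
    at-least-d v j = subst (d ≤_) (sym (colourDegree≡countAt G c j v))
      (group-lower γ (equitable v) j d (begin
        groupSize γ (γ j) * d        ≤⟨ *-monoˡ-≤ d (groupSize≤m γ (γ j)) ⟩
        m * d                        ≤⟨ minimum-degree G (edge-connected (γ j)) v ⟩
        groupDegree (γ j) v          ≡⟨ groupSum≡ (γ j) v ⟨
        groupSum γ (equitable v) (γ j) ∎))
      where open ≤-Reasoning
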